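{- Let $\Phi$ and $\Psi$ be two sets of Sudoku propositions. If $\Phi \vdash \Psi$ then $\Phi \models \Psi$.
   Context: A Sudoku proposition is a formal symbol $r_ic_j \not\approx d$ with $i,j,d\in\{1,\dots,9\}$. Sudoku formulas are built inductively from Sudoku propositions and the constants $\top,\bot$ using $\lnot,\land,\lor,\Rightarrow,\Leftrightarrow$. A grid is a $9\times 9$ matrix $\mathcal{A}=[A_{ij}]_{9\times 9}$ of nonempty subsets $A_{ij}\subseteq\{1,\dots,9\}$; it is full if $|A_{ij}|=1$ for all $i,j$. Satisfaction $\mathcal{A}\models\phi$: $\mathcal{A}\models\top$ always, $\mathcal{A}\models\bot$ never, $\mathcal{A}\models r_ic_j\not\approx d$ iff $d\notin A_{ij}$, and the connectives are interpreted classically (two-valued truth tables). For a set $\Phi$ of formulas, $\mathcal{A}\models\Phi$ means $\mathcal{A}\models\phi$ for all $\phi\in\Phi$. Write $r_ic_j\equiv d$ for $\bigwedge_{s\ne d} r_ic_j\not\approx s$, and $r_ic_j\parallel r_\ell c_m$ for $\bigwedge_{1\le d\le 9}((r_ic_j\equiv d\Rightarrow r_\ell c_m\not\approx d)\land(r_\ell c_m\equiv d\Rightarrow r_ic_j\not\approx d))$. The set $\Sigma_{ax}$ consists of 27 formulas, one for each row, each column and each of the nine standard $3\times 3$ boxes: the conjunction of $r_ic_j\parallel r_\ell c_m$ over all pairs of distinct cells in that row, column or box. A Sudoku grid is a grid $\mathcal{A}$ with $\mathcal{A}\models\Sigma_{ax}$ (i.e. whenever $A_{ij}=\{d\}$,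 $d$ belongs to no $A_{\ell m}$ for another cell in the same row, column or box). A full Sudoku grid is a Sudoku grid that is full. A Sudoku axiom is a Sudoku formula that holds in every full Sudoku grid; $\Delta_{ax}$ is the set of all Sudoku axioms. For a set $\Phi$ of Sudoku formulas and a Sudoku formula $\alpha$, $\Phi\vdash\alpha$ means there is a finite sequence $\phi_1,\dots,\phi_n=\alpha$ of Sudoku formulas such that each $\phi_i$ is in $\Delta_{ax}$, or in $\Phi$, or is obtained by modus ponens from earlier formulas (there are $p,q<i$ with $\phi_q$ equal to $\phi_p\Rightarrow\phi_i$). $\Phi\vdash\Psi$ means $\Phi\vdash\alpha$ for all $\alpha\in\Psi$. A grid $\mathcal{S}=[S_{ij}]$ is a solution of a grid $\mathcal{A}=[A_{ij}]$ if $\mathcal{S}$ is full and $S_{ij}\subseteq A_{ij}$ for all $i,j$. For sets $\Phi,\Psi$ of Sudoku propositions, $\Phi\models\Psi$ means: for every Sudoku grid $\mathcal{A}$ with $\mathcal{A}\models\Phi$, and every full Sudoku grid $\mathcal{S}$ which is a solution of $\mathcal{A}$, $\mathcal{S}\models\Psi$. -}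

module Defs where

open import Data.Bool.Base using (Bool; true; false; T; not; _∧_; _∨_; _xor_)
open import Data.Fin.Base using (Fin; combine; fromℕ; quotient; remainder; _<_)
open import Data.Fin.Properties using (_≟_; _<?_)
open import Data.Fin.Subset using (Subset; Nonempty; _⊆_; ∣_∣)
open import Data.Fin.Subset.Properties using (_∈?_)
open import Data.List.Base using (List; allFin; concatMap; filter; foldr; map)
open import Data.Nat.Base using (ℕ; suc)
open import Data.Product.Base using (Σ-syntax; ∃-syntax; _×_; _,_)
open import Data.Sum.Base using (_⊎_)
open import Level using (0ℓ; _⊔_)
open import Relation.Binary.PropositionalEquality.Core using (_≡_)
open import Relation.Nullary.Decidable using (does; ¬?)
open import Relation.Unary using (Pred; _∈_)

-- The numbers 1, …, 9 (for rows, columns and digits alike) are represented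
-- by the nine elements of Fin 9.
Cell : Set
Cell = Fin 9 × Fin 9

infix 8 _≉_

-- (i , j) ≉ d is the symbol  rᵢcⱼ ≉ d.
data Proposition : Set where
  _≉_ : Cell → Fin 9 → Proposition

infix  7 ¬ᶠ_
infixr 6 _∧ᶠ_
infixr 5 _∨ᶠ_
infixr 4 _⇒ᶠ_
infix  3 _⇔ᶠ_

data Formula : Set where
  prop                      : Proposition → Formula
  ⊤ᶠ ⊥ᶠ                     : Formula
  ¬ᶠ_                       : Formula → Formula
  _∧ᶠ_ _∨ᶠ_ _⇒ᶠ_ _⇔ᶠ_       : Formula → Formula → Formula

record Grid : Set where
  field
    entry    : Fin 9 → Fin 9 → Subset 9
    nonempty : ∀ i j → Nonempty (entry i j)

open Grid public

Full : Pred Grid 0ℓ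
Full 𝒜 = ∀ i j → ∣ entry 𝒜 i j ∣ ≡ 1

eval : Grid → Formula → Bool
eval 𝒜 (prop ((i , j) ≉ d)) = does (¬? (d ∈? entry 𝒜 i j))
eval 𝒜 ⊤ᶠ                   = true
eval 𝒜 ⊥ᶠ                   = false
eval 𝒜 (¬ᶠ φ)               = not (eval 𝒜 φ)
eval 𝒜 (φ ∧ᶠ ψ)             = eval 𝒜 φ ∧ eval 𝒜 ψ
eval 𝒜 (φ ∨ᶠ ψ)             = eval 𝒜 φ ∨ eval 𝒜 ψ
eval 𝒜 (φ ⇒ᶠ ψ)             = not (eval 𝒜 φ) ∨ eval 𝒜 ψ
eval 𝒜 (φ ⇔ᶠ ψ)             = not (eval 𝒜 φ xor eval 𝒜 ψ)

infix 2 _⊨_ _⊨ˢ_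

_⊨_ : Grid → Formula → Set
𝒜 ⊨ φ = T (eval 𝒜 φ)

_⊨ˢ_ : ∀ {ℓ} → Grid → Pred Formula ℓ → Set ℓ
𝒜 ⊨ˢ Φ = ∀ φ → φ ∈ Φ → 𝒜 ⊨ φ

⋀ : List Formula → Formula
⋀ = foldr _∧ᶠ_ ⊤ᶠ

infix 8 _≡ᶠ_ _∥_

_≡ᶠ_ : Cell → Fin 9 → Formula
x ≡ᶠ d = ⋀ (map (λ s → prop (x ≉ s)) (filter (λ s → ¬? (s ≟ d)) (allFin 9)))

_∥_ : Cell → Cell → Formula
x ∥ y = ⋀ (map (λ d → (x ≡ᶠ d ⇒ᶠ prop (y ≉ d)) ∧ᶠ (y ≡ᶠ d ⇒ᶠ prop (x ≉ d)))
               (allFin 9))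

data Unit : Set where
  row column box : Fin 9 → Unit

-- Boxes, and the cells inside a box, are numbered
-- in reading order: combine m k : Fin (3 * 3) has value 3 m + k, and quotient
-- and remainder are its two inverse components.
cell : Unit → Fin 9 → Cell
cell (row i)    k = i , k
cell (column j) k = k , j
cell (box b)    k = combine (quotient {3} 3 b) (quotient {3} 3 k)
                  , combine (remainder {3} 3 b) (remainder {3} 3 k)

-- Since x ∥ y is symmetric in x and y, each unordered pair of distinct cells
-- of the unit is listed once.
unitAxiom : Unit → Formula
unitAxiom u =
  ⋀ (concatMap (λ k → map (λ l → cell u k ∥ cell u l)
                          (filter (k <?_) (allFin 9)))
               (allFin 9))

Σax : Pred Formula 0ℓ
Σax φ = ∃[ u ] φ ≡ unitAxiom u

SudokuGrid : Pred Grid 0ℓ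
SudokuGrid 𝒜 = 𝒜 ⊨ˢ Σax

FullSudokuGrid : Pred Grid 0ℓ
FullSudokuGrid 𝒜 = SudokuGrid 𝒜 × Full 𝒜

Δax : Pred Formula 0ℓ
Δax φ = ∀ 𝒮 → FullSudokuGrid 𝒮 → 𝒮 ⊨ φ

infix 2 _⊢_ _⊢ˢ_ _⊫_

_⊢_ : ∀ {ℓ} → Pred Formula ℓ → Formula → Set ℓ
Φ ⊢ α =
  Σ[ n ∈ ℕ ] Σ[ φ ∈ (Fin (suc n) → Formula) ]
    (φ (fromℕ n) ≡ α) ×
    (∀ i → φ i ∈ Δax
         ⊎ φ i ∈ Φ
         ⊎ (∃[ p ] ∃[ q ] p < i × q < i × φ q ≡ (φ p ⇒ᶠ φ i)))

_⊢ˢ_ : ∀ {ℓ₁ ℓ₂} → Pred Formula ℓ₁ → Pred Formula ℓ₂ → Set (ℓ₁ ⊔ ℓ₂)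
Φ ⊢ˢ Ψ = ∀ α → α ∈ Ψ → Φ ⊢ α

⌜_⌝ : ∀ {ℓ} → Pred Proposition ℓ → Pred Formula ℓ
⌜ Φ ⌝ φ = ∃[ π ] π ∈ Φ × φ ≡ prop π

_IsSolutionOf_ : Grid → Grid → Set
𝒮 IsSolutionOf 𝒜 = Full 𝒮 × (∀ i j → entry 𝒮 i j ⊆ entry 𝒜 i j)

_⊫_ : ∀ {ℓ₁ ℓ₂} → Pred Proposition ℓ₁ → Pred Proposition ℓ₂ → Set (ℓ₁ ⊔ ℓ₂)
Φ ⊫ Ψ = ∀ 𝒜 → SudokuGrid 𝒜 → 𝒜 ⊨ˢ ⌜ Φ ⌝ →
        ∀ 𝒮 → FullSudokuGrid 𝒮 → 𝒮 IsSolutionOf 𝒜 → 𝒮 ⊨ˢ ⌜ Ψ ⌝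

{-# OPTIONS --safe #-}
-- Refining the entries of a grid preserves the truth of Sudoku propositions, so
-- a solution 𝒮 of 𝒜 satisfies Φ whenever 𝒜 does; and every line of a derivation
-- from Φ holds in every full Sudoku grid satisfying Φ.
module Submission where

open import Defs
open import Data.Bool.Base using (true; T; not; _∨_)
open import Data.Fin.Base using (fromℕ; _<_)
open import Data.Fin.Induction using (<-wellFounded)
open import Data.Fin.Subset using (_⊆_)
open import Data.Fin.Subset.Properties using (_∈?_)
open import Data.Product.Base using (_,_)
open import Data.Sum.Base using (inj₁; inj₂)
open import Induction.WellFounded using (Acc; acc)
open import Relation.Binary.PropositionalEquality.Core using (refl; subst)
open import Relation.Nullary using (yes; no; contradiction)
open import Relation.Unary using (Pred)

modusPonens : ∀ {a b} → T (not a ∨ b) → T a → T b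
modusPonens {a = true} a⇒b _ = a⇒b

-- A proposition only denies that a digit lies in an entry, and denial persists as entries shrink.
-- Negated propositions need not persist.
⊨-antitone : ∀ {𝒜 𝒮} → (∀ i j → entry 𝒮 i j ⊆ entry 𝒜 i j) →
  ∀ π → 𝒜 ⊨ prop π → 𝒮 ⊨ prop π
⊨-antitone {𝒜} {𝒮} 𝒮⊆𝒜 ((i , j) ≉ d) 𝒜⊨π
  with d ∈? entry 𝒜 i j | d ∈? entry 𝒮 i j
-- If `d` lies in both entries, the type of `𝒜⊨π` is empty, so that case is absent.
... | _      | no _    = _
... | no d∉𝒜 | yes d∈𝒮 = contradiction (𝒮⊆𝒜 i j d∈𝒮) d∉𝒜

⊢-sound : ∀ {ℓ} {Φ : Pred Formula ℓ} {α 𝒮} →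
  FullSudokuGrid 𝒮 → 𝒮 ⊨ˢ Φ → Φ ⊢ α → 𝒮 ⊨ α
⊢-sound {𝒮 = 𝒮} full 𝒮⊨Φ (n , φ , refl , justified) =
  line (fromℕ n) (<-wellFounded _)
  where
  -- Modus ponens may cite any earlier lines, hence strong induction on the index.
  line : ∀ i → Acc _<_ i → 𝒮 ⊨ φ i
  line i (acc rs) with justified i
  ... | inj₁ axiom                              = axiom 𝒮 full
  ... | inj₂ (inj₁ φᵢ∈Φ)                        = 𝒮⊨Φ (φ i) φᵢ∈Φ
  ... | inj₂ (inj₂ (p , q , p<i , q<i , φq≡⇒)) =
    modusPonens (subst (𝒮 ⊨_) φq≡⇒ (line q (rs q<i))) (line p (rs p<i))

theorem5p3 : ∀ {ℓ₁ ℓ₂} (Φ : Pred Proposition ℓ₁) (Ψ : Pred Proposition ℓ₂) →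
    ⌜ Φ ⌝ ⊢ˢ ⌜ Ψ ⌝ → Φ ⊫ Ψ
theorem5p3 Φ Ψ Φ⊢Ψ 𝒜 _ 𝒜⊨Φ 𝒮 full (_ , 𝒮⊆𝒜) α α∈Ψ =
  ⊢-sound full 𝒮⊨Φ (Φ⊢Ψ α α∈Ψ)
  where
  -- Soundness is applied in `𝒮`, not `𝒜`: Sudoku axioms may fail in a grid that is not full.
  𝒮⊨Φ : 𝒮 ⊨ˢ ⌜ Φ ⌝
  𝒮⊨Φ _ (π , π∈Φ , refl) =
    ⊨-antitone {𝒜} {𝒮} 𝒮⊆𝒜 π (𝒜⊨Φ (prop π) (π , π∈Φ , refl))
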